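{- For every pair of integers $t,k\in\mathbb{N}$ there exists $N\in\mathbb{N}$ such that every graph that excludes $P_t$, $\widetilde{P_t}$, and $H_k$ as semi-induced subgraphs admits a $2$-cosplit of size at most $N$ and height at most $4k$.
   Context: For disjoint $A,B\subseteq V(G)$, $G[A,B]$ is the bipartite graph with bipartition $\{A,B\}$ whose edges are the edges of $G$ with one endpoint in $A$ and the other in $B$; a bipartite graph $H$ is a semi-induced subgraph of $G$ if $G[A,B]$ is isomorphic to $H$ (as a bipartite graph) for some disjoint $A,B$. $P_t$ is the path on $t$ vertices (with its unique bipartition) and $\widetilde{P_t}$ its bipartite complement (complementing adjacency between the two sides only). The half-graph $H_k$ is the bipartite graph with sides $\{a_1,\dots,a_k\}$, $\{b_1,\dots,b_k\}$ and edges $a_ib_j$ for $1\le i\le j\le k$. A cotree of height at most $h$: a rooted tree $T$ of height at most $h$ (max edges on root-to-leaf path) with $f:I(T)\to\{0,1\}$ on internal vertices, defining the graph on the leaves in which distinct leaves $u,v$ are adjacent iff $f(u\wedge v)=1$ ($u\wedge v$ = lowest common ancestor). A cograph of height at most $h$ is a graph defined by such a cotree. A bi-cotree of height at most $h$: a rooted tree $T$ of height at most $h$, a map $c$ from leaves to $\{1,2\}$ and $f:I(T)\times[2]\times[2]\to\{0,1\}$ symmetric in its last two arguments with $f(x,1,1)=f(x,2,2)=0$; it defines the bipartite graph on the leaves with sides $c^{ -1}(1),c^{ -1}(2)$ where $u,v$ are adjacent iff $f(u\wedge v,c(u),c(v))=1$. A bi-cograph of height at most $h$ is a bipartite graph defined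 by such a bi-cotree whose coloring $c$ is its bipartition. A $2$-cosplit of $G$ is a partition $\mathscr{P}$ of $V(G)$ such that $G[A]$ is a cograph for each $A\in\mathscr{P}$ and $G[A,B]$ is a bi-cograph for each pair of distinct $A,B\in\mathscr{P}$. Its size is $|\mathscr{P}|$; it has height at most $h$ if all these cographs $G[A]$ and bi-cographs $G[A,B]$ have height at most $h$. -}

module Defs where

open import Data.Nat using (ℕ; zero; suc; _≤_; ⌊_/2⌋; ⌈_/2⌉; _≡ᵇ_; _≤ᵇ_)
open import Data.Fin using (Fin; toℕ)
open import Data.Bool using (Bool; true; false; not; _∨_)
open import Data.List using (List; []; _∷_; concatMap; allFin)
open import Data.List.Membership.Propositional using (_∈_)
open import Data.List.Relation.Unary.Unique.Propositional using (Unique)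
open import Data.Product using (Σ; ∃; _×_; _,_)
open import Data.Sum using (_⊎_)
open import Relation.Binary.PropositionalEquality using (_≡_; _≢_)
open import Function.Bundles using (_⇔_)
open import Function.Definitions using (Injective)

record Graph : Set where
  field
    n      : ℕ
    adj    : Fin n → Fin n → Bool
    sym    : ∀ u v → adj u v ≡ adj v u
    irrefl : ∀ v → adj v v ≡ false
open Graph public

record BiGraph : Set where
  field
    p   : ℕ
    q   : ℕ
    rel : Fin p → Fin q → Bool
open BiGraph public

SemiInduced : BiGraph → Graph → Set
SemiInduced H G =
  Σ (Fin (p H) → Fin (n G)) λ α →
  Σ (Fin (q H) → Fin (n G)) λ β →
    Injective _≡_ _≡_ α × Injective _≡_ _≡_ β
    × (∀ i j → α i ≢ β j)
    × (∀ i j → adj G (α i) (β j) ≡ rel H i j)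

-- The path P_t on vertices 0,…,t-1 with its bipartition:
-- left vertex i is path vertex 2i, right vertex j is path vertex 2j+1.
-- 2i ~ 2j+1 iff i = j or i = j+1.
PathBi : ℕ → BiGraph
PathBi t = record
  { p = ⌈ t /2⌉ ; q = ⌊ t /2⌋
  ; rel = λ i j → (toℕ i ≡ᵇ toℕ j) ∨ (toℕ i ≡ᵇ suc (toℕ j)) }

biComplement : BiGraph → BiGraph
biComplement H = record { p = p H ; q = q H ; rel = λ i j → not (rel H i j) }

HalfGraph : ℕ → BiGraph
HalfGraph k = record { p = k ; q = k ; rel = λ i j → toℕ i ≤ᵇ toℕ j }

data Tree (V : Set) : ℕ → Set where
  leaf : ∀ {h} → V → Tree V h
  node : ∀ {h} (m : ℕ) → Bool → (Fin m → Tree V h) → Tree V (suc h)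

leaves : ∀ {V h} → Tree V h → List V
leaves (leaf v)     = v ∷ []
leaves (node m b c) = concatMap (λ i → leaves (c i)) (allFin m)

data Lca {V : Set} : ∀ {h} → Tree V h → V → V → Bool → Set where
  here  : ∀ {h m b} {c : Fin m → Tree V h} {u v} (i j : Fin m) → i ≢ j →
          u ∈ leaves (c i) → v ∈ leaves (c j) → Lca (node m b c) u v b
  there : ∀ {h m b b'} {c : Fin m → Tree V h} {u v} (i : Fin m) →
          Lca (c i) u v b' → Lca (node m b c) u v b'

IsCographOn : (G : Graph) → (Fin (n G) → Set) → ℕ → Set
IsCographOn G A h =
  Σ (Tree (Fin (n G)) h) λ T →
    Unique (leaves T)
    × (∀ v → (v ∈ leaves T) ⇔ A v)
    × (∀ u v → A u → A v → u ≢ v → ∃ λ b → Lca T u v b × adj G u v ≡ b)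

-- G[A,B] is a bi-cograph of height at most h: a bi-cotree of height ≤ h
-- whose leaves are exactly A ∪ B, coloured c = 1 on A and c = 2 on B.
-- Since f(x,·,·) is symmetric with f(x,1,1) = f(x,2,2) = 0, f is
-- determined by the bit f(x,1,2), which is the node label in Tree.
-- Same-side pairs are non-adjacent in G[A,B] and get f = 0 automatically,
-- so the only condition is on pairs u ∈ A, v ∈ B.
IsBiCographOn : (G : Graph) → (Fin (n G) → Set) → (Fin (n G) → Set) → ℕ → Set
IsBiCographOn G A B h =
  Σ (Tree (Fin (n G)) h) λ T →
    Unique (leaves T)
    × (∀ v → (v ∈ leaves T) ⇔ (A v ⊎ B v))
    × (∀ u v → A u → B v → ∃ λ b → Lca T u v b × adj G u v ≡ b)

Is2Cosplit : (G : Graph) (s : ℕ) → (Fin (n G) → Fin s) → ℕ → Set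
Is2Cosplit G s P h =
    (∀ i → ∃ λ v → P v ≡ i)
  × (∀ i → IsCographOn G (λ v → P v ≡ i) h)
  × (∀ i j → i ≢ j → IsBiCographOn G (λ v → P v ≡ i) (λ v → P v ≡ j) h)

{-# OPTIONS --safe #-}
module Submission where

-- Fix b ∈ {0,1}. Inside a component (of the graph of b-coloured pairs) hanging from a vertex x, remove
-- the neighbours of x; each component of the rest hangs from a removed vertex, and so on. The
-- vertices x, x', x'', … used along one branch form an induced path, so there are boundedly many
-- levels (Gyárfás' argument). Removed vertices are all b-adjacent to the current tip and b-nonadjacent
-- to the previous one. Such a pair (w full, y empty) is a new rung of a half-graph with arbitrary
-- diagonal, of which there are fewer than 2k. Only the first level has no previous tip: it gives a full
-- vertex only, and one round for the other value of b, started opposite that vertex, supplies the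
-- empty one. Every rung costs at most two levels of a cotree. The argument is run once on G itself,
-- which yields classes X inducing cographs, and once on each bipartite graph G[X, V ∖ X].

open import Defs
open import Data.Nat using (ℕ; zero; suc; _+_; _*_; _^_; _≤_; _<_; z≤n; s≤s; _≡ᵇ_; _≤ᵇ_; ⌊_/2⌋; ⌈_/2⌉)
import Data.Nat.Properties as ℕ
open import Data.Fin using (Fin; zero; suc; toℕ; combine; funToFin; finToFun; _↑ˡ_; _↑ʳ_; splitAt)
import Data.Fin.Properties as Fin
open import Data.Bool using (Bool; true; false; not; _∨_; if_then_else_)
import Data.Bool.Properties as Bool
open import Data.Empty using (⊥; ⊥-elim)
open import Data.Unit using (⊤; tt)
open import Data.List using (List; []; _∷_; [_]; length; lookup; concat; concatMap; tabulate; filter; allFin; cartesianProduct)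
import Data.List.Properties as List
open import Data.List.Membership.Propositional using (_∈_)
open import Data.List.Membership.Propositional.Properties
  using (∈-allFin; ∈-filter⁺; ∈-filter⁻; ∈-cartesianProduct⁺; ∈-concat⁺′; ∈-concat⁻′; ∈-tabulate⁺; ∈-tabulate⁻)
open import Data.List.Relation.Unary.Any using (here; there)
open import Data.List.Relation.Unary.All as All using (All; []; _∷_)
import Data.List.Relation.Unary.All.Properties as Allₚ
import Data.List.Relation.Unary.AllPairs.Properties as AllPairs
open import Data.List.Relation.Unary.Unique.Propositional using (Unique)
import Data.List.Relation.Unary.Unique.Propositional.Properties as Unique
open import Data.Product using (Σ; ∃; _×_; _,_; proj₁; proj₂)
open import Data.Sum using (_⊎_; inj₁; inj₂; [_,_]′)
open import Data.Sum.Properties using (inj₁-injective; inj₂-injective)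
open import Function using (_∘_; id; const)
open import Function.Bundles using (_⇔_; mk⇔; Equivalence)
open import Function.Definitions using (Injective)
open import Relation.Binary.PropositionalEquality
  using (_≡_; _≢_; refl; trans; cong; cong₂; subst; ≢-sym) renaming (sym to ≡-sym)
open import Relation.Nullary using (¬_; Dec; yes; no; contradiction; ⌊_⌋; _×-dec_; _⊎-dec_; _→-dec_; ¬?)
open import Relation.Nullary.Decidable using (decidable-stable)
open import Relation.Unary using (Decidable)
open import Relation.Binary.Definitions using (tri<; tri≈; tri>)

-- Concatenated families of lists.

concatMap-allFin : ∀ {A : Set} {m} (f : Fin m → List A) →
  concatMap f (allFin m) ≡ concat (tabulate f)
concatMap-allFin f = cong concat (List.map-tabulate id f)

∈-concatMap-allFin : ∀ {A : Set} {m} (f : Fin m → List A) {a} →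
  (∃ λ i → a ∈ f i) ⇔ (a ∈ concatMap f (allFin m))
∈-concatMap-allFin f {a} rewrite concatMap-allFin f = mk⇔
  (λ (i , a∈fi) → ∈-concat⁺′ a∈fi (∈-tabulate⁺ i))
  λ a∈ → let _ , a∈xs , xs∈ = ∈-concat⁻′ (tabulate f) a∈
             i , xs≡fi = ∈-tabulate⁻ xs∈
         in i , subst (a ∈_) xs≡fi a∈xs

unique-concatMap-allFin : ∀ {A : Set} {m} (f : Fin m → List A) →
  (∀ i → Unique (f i)) → (∀ {i j a} → a ∈ f i → a ∈ f j → i ≡ j) →
  Unique (concatMap f (allFin m))
unique-concatMap-allFin f uniq disj rewrite concatMap-allFin f = Unique.concat⁺
  (Allₚ.tabulate⁺ uniq)
  (AllPairs.tabulate⁺ λ i≢j (a∈fi , a∈fj) → i≢j (disj a∈fi a∈fj))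

⌊⌋-transport : ∀ {A B : Set} (a? : Dec A) (b? : Dec B) → ⌊ a? ⌋ ≡ ⌊ b? ⌋ → A → B
⌊⌋-transport (yes _) (yes b) _ _ = b
⌊⌋-transport (no ¬a) (no _)  _ a = contradiction a ¬a

-- Connected components of a decidable relation.

record Components {n} (R : Fin n → Fin n → Set) : Set₁ where
  field
    label  : Fin n → Fin n
    joined : ∀ {u v} → R u v → label u ≡ label v
    -- Expresses connectedness in the symmetric closure of `R` without mentioning walks; `Q` will
    -- be, for instance, membership in a fixed smaller component.
    closed : (Q : Fin n → Set) → (∀ {u v} → R u v → Q u ⇔ Q v) →
             ∀ {u v} → label u ≡ label v → Q u → Q v

abstract
  -- Union-find: from singleton classes, all pairs are processed in turn, and at a related pair the
  -- class of the first vertex takes the label of the second.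
  components : ∀ {n} {R : Fin n → Fin n → Set} → (∀ u v → Dec (R u v)) → Components R
  components {n} {R} R? =
    let label , joined , closed = merge-all (cartesianProduct (allFin n) (allFin n))
    in record { label  = label
              ; joined = joined (∈-cartesianProduct⁺ (∈-allFin _) (∈-allFin _))
              ; closed = closed }
    where
    Closed : (Fin n → Fin n) → Set₁
    Closed c = (Q : Fin n → Set) → (∀ {u v} → R u v → Q u ⇔ Q v) → ∀ {u v} → c u ≡ c v → Q u → Q v

    relabel : (Fin n → Fin n) → Fin n → Fin n → Fin n → Fin n
    relabel c a b w with c w Fin.≟ c a
    ... | yes _ = c b
    ... | no  _ = c w

    relabel-cong : ∀ c a b {u v} → c u ≡ c v → relabel c a b u ≡ relabel c a b v
    relabel-cong c a b {u} {v} cu≡cv with c u Fin.≟ c a | c v Fin.≟ c a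
    ... | yes _  | yes _  = refl
    ... | yes p  | no ¬q  = contradiction (trans (≡-sym cu≡cv) p) ¬q
    ... | no ¬p  | yes q  = contradiction (trans cu≡cv q) ¬p
    ... | no _   | no _   = cu≡cv

    relabel-joins : ∀ c a b → relabel c a b a ≡ relabel c a b b
    relabel-joins c a b with c a Fin.≟ c a | c b Fin.≟ c a
    ... | yes _ | yes _ = refl
    ... | yes _ | no _  = refl
    ... | no ¬p | _     = contradiction refl ¬p

    relabel-closed : ∀ c {a b} → R a b → Closed c → Closed (relabel c a b)
    relabel-closed c {a} {b} ab cl Q inv {u} {v} eq qu with c u Fin.≟ c a | c v Fin.≟ c a
    ... | yes p | yes q = cl Q inv (trans p (≡-sym q)) qu
    ... | yes p | no _  = cl Q inv eq (Equivalence.to (inv ab) (cl Q inv p qu))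
    ... | no _  | yes q = cl Q inv (≡-sym q) (Equivalence.from (inv ab) (cl Q inv eq qu))
    ... | no _  | no _  = cl Q inv eq qu

    merge-all : (L : List (Fin n × Fin n)) → Σ (Fin n → Fin n) λ c →
      (∀ {u v} → (u , v) ∈ L → R u v → c u ≡ c v) × Closed c
    merge-all [] = id , (λ ()) , λ { Q inv refl qu → qu }
    merge-all ((a , b) ∷ L) with merge-all L | R? a b
    ... | c , joins , cl | no ¬ab = c , (λ { (here refl) ab → contradiction ab ¬ab ; (there m) → joins m }) , cl
    ... | c , joins , cl | yes ab = relabel c a b
        , (λ { (here refl) _ → relabel-joins c a b ; (there m) r → relabel-cong c a b (joins m r) })
        , relabel-closed c ab cl

-- Palettes of the colourings.

LevelColour : Set → ℕ → Set
LevelColour C zero    = ⊤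
LevelColour C (suc r) = Bool × C × LevelColour C r

-- In `LevelColour` each level records whether a vertex survives the removal, together with its
-- recursive colour. The two bits added here record survival of the root removal and adjacency to
-- the root.
RootColour : Set → ℕ → Set
RootColour C r = Bool × Bool × LevelColour C r

-- The left summand serves pieces where a rung is available at once, the right one the first-level
-- pieces, which go through a round for the other value of `b`.
MainColour : ℕ → ℕ → Set
MainColour r zero    = ⊤
MainColour r (suc m) = RootColour (MainColour r m ⊎ RootColour (MainColour r m) r) r

level-point : ∀ {C} r → C → LevelColour C r
level-point zero    c = tt
level-point (suc r) c = true , c , level-point r c

point : ∀ r m → MainColour r m
point r zero    = tt
point r (suc m) = true , true , level-point r (inj₁ (point r m))

-- Positions on a path and finite sequences.

half-bound : ∀ t i → i < ⌊ t /2⌋ → suc (i * 2) < t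
half-bound (suc (suc t)) zero    _ = s≤s (s≤s z≤n)
half-bound (suc (suc t)) (suc i) (s≤s i<) = s≤s (s≤s (half-bound t i i<))

ceil-half-bound : ∀ t i → i < ⌈ t /2⌉ → i * 2 < t
ceil-half-bound t i i< = ℕ.≤-pred (half-bound (suc t) i i<)

consecutive : ℕ → ℕ → Bool
consecutive i j = (i ≡ᵇ j) ∨ (i ≡ᵇ suc j)

-- Path vertex `2i` against path vertex `2j+1`: one step before it, one step after it, or at
-- distance at least 3 on either side.
data Position (i j : ℕ) : Set where
  equal  : i ≡ j → consecutive i j ≡ true → Position i j
  next   : i ≡ suc j → consecutive i j ≡ true → Position i j
  before : i < j → consecutive i j ≡ false → Position i j
  after  : suc j < i → consecutive i j ≡ false → Position i j

position : ∀ i j → Position i j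
position zero          zero    = equal refl refl
position zero          (suc j) = before (s≤s z≤n) refl
position (suc zero)    zero    = next refl refl
position (suc (suc i)) zero    = after (s≤s (s≤s z≤n)) refl
position (suc i)       (suc j) with position i j
... | equal  p q = equal  (cong suc p) q
... | next   p q = next   (cong suc p) q
... | before p q = before (s≤s p) q
... | after  p q = after  (s≤s p) q

nth : {A : Set} → A → List A → ℕ → A
nth d []       _       = d
nth d (x ∷ xs) zero    = x
nth d (x ∷ xs) (suc i) = nth d xs i

nth-all : {A : Set} {P : A → Set} {d : A} {xs : List A} → All P xs → ∀ {i} → i < length xs → P (nth d xs i)
nth-all (px ∷ _)   {zero}  _        = px
nth-all (_  ∷ pxs) {suc i} (s≤s i<) = nth-all pxs i<

snoc : {A : Set} → ℕ → (ℕ → A) → A → ℕ → A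
snoc zero    f x _       = x
snoc (suc m) f x zero    = f zero
snoc (suc m) f x (suc i) = snoc m (f ∘ suc) x i

snoc-init : {A : Set} → ∀ m (f : ℕ → A) x {i} → i < m → snoc m f x i ≡ f i
snoc-init (suc m) f x {zero}  _        = refl
snoc-init (suc m) f x {suc i} (s≤s i<) = snoc-init m (f ∘ suc) x i<

snoc-last : {A : Set} → ∀ m (f : ℕ → A) x → snoc m f x m ≡ x
snoc-last zero    f x = refl
snoc-last (suc m) f x = snoc-last m (f ∘ suc) x

≤ᵇ-true : ∀ {i j} → i ≤ j → (i ≤ᵇ j) ≡ true
≤ᵇ-true = Equivalence.to Bool.T-≡ ∘ ℕ.≤⇒≤ᵇ

≤ᵇ-false : ∀ {i j} → j < i → (i ≤ᵇ j) ≡ false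
≤ᵇ-false j<i = Bool.¬-not λ eq → ℕ.<⇒≱ j<i (ℕ.≤ᵇ⇒≤ _ _ (Equivalence.from Bool.T-≡ eq))

pathGraph : Bool → ℕ → BiGraph
pathGraph true  t = PathBi t
pathGraph false t = biComplement (PathBi t)

-- With side constant and op = id every pair of distinct vertices is considered (cographs); with
-- op = not only the pairs with ends on different sides are (bi-cographs).
module Split (G : Graph) (side : Fin (n G) → Bool) (op : Bool → Bool)
             (op-involutive : ∀ b → op (op b) ≡ b)
             (two-sided : ∀ u x → side x ≡ side u ⊎ side x ≡ op (side u)) where

  -- Pairs across and `b`-coloured edges.

  V : Set
  V = Fin (n G)

  Across : V → V → Set
  Across u v = side v ≡ op (side u) × u ≢ v

  Across? : ∀ u v → Dec (Across u v)
  Across? u v = (side v Bool.≟ op (side u)) ×-dec ¬? (u Fin.≟ v)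

  across-sym : ∀ {u v} → Across u v → Across v u
  across-sym {u} (eq , u≢v) = trans (≡-sym (op-involutive _)) (cong op (≡-sym eq)) , ≢-sym u≢v

  across-same : ∀ {w u v} → Across w u → Across w v → side u ≡ side v
  across-same (p , _) (q , _) = trans p (≡-sym q)

  -- `x` is on the side of `u` or on the opposite one, where `v` is. A property known only on the
  -- side of one vertex thus reaches an end of every across pair.
  across-meets : ∀ {u v} x → Across u v → side u ≡ side x ⊎ side v ≡ side x
  across-meets {u} x (eq , _) with two-sided u x
  ... | inj₁ q = inj₁ (≡-sym q)
  ... | inj₂ q = inj₂ (trans eq (≡-sym q))

  Edge : Bool → V → V → Set
  Edge b u v = Across u v × adj G u v ≡ b

  Edge? : ∀ b u v → Dec (Edge b u v)
  Edge? b u v = Across? u v ×-dec (adj G u v Bool.≟ b)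

  edge-sym : ∀ {b u v} → Edge b u v → Edge b v u
  edge-sym {u = u} {v} (ac , eq) = across-sym ac , trans (sym G v u) eq

  nonedge : ∀ {b u v} → Across u v → ¬ Edge b u v → adj G u v ≡ not b
  nonedge ac ¬e = Bool.¬-not (λ eq → ¬e (ac , eq))

  -- Cotrees with independent leaf sets.

  Independent : (V → Set) → Set
  Independent S = ∀ {u v} → S u → S v → ¬ Across u v

  -- A cotree of height h whose leaf sets are independent; c u names the child of the root containing u.
  Good : ℕ → (V → Set) → Set
  Good zero    S = Independent S
  Good (suc h) S = Independent S ⊎ Σ Bool λ b → Σ (V → V) λ c →
    (∀ {u v} → S u → S v → Across u v → c u ≢ c v → adj G u v ≡ b)
    × (∀ z → Good h (λ u → S u × c u ≡ z))

  independent⇒good : ∀ h {S} → Independent S → Good h S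
  independent⇒good zero    ind = ind
  independent⇒good (suc h) ind = inj₁ ind

  good-⊆ : ∀ h {S S′ : V → Set} → (∀ {u} → S′ u → S u) → Good h S → Good h S′
  good-⊆ zero    sub ind = λ su sv → ind (sub su) (sub sv)
  good-⊆ (suc h) sub (inj₁ ind) = inj₁ λ su sv → ind (sub su) (sub sv)
  good-⊆ (suc h) sub (inj₂ (b , c , crossing , pieces)) =
    inj₂ (b , c , (λ su sv → crossing (sub su) (sub sv))
               , λ z → good-⊆ h (λ (su , eq) → sub su , eq) (pieces z))

  good-suc : ∀ h {S} → Good h S → Good (suc h) S
  good-suc zero    ind = inj₁ ind
  good-suc (suc h) (inj₁ ind) = inj₁ ind
  good-suc (suc h) (inj₂ (b , c , crossing , pieces)) =
    inj₂ (b , c , crossing , λ z → good-suc h (pieces z))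

  Realizes : ∀ {h} → Tree V h → (V → Set) → Set
  Realizes T S = Unique (leaves T)
    × (∀ v → (v ∈ leaves T) ⇔ S v)
    × (∀ {u v} → S u → S v → Across u v → ∃ λ b → Lca T u v b × adj G u v ≡ b)

  star-realizes : ∀ h {S} → Decidable S → Independent S → Σ (Tree V (suc h)) λ T → Realizes T S
  -- The label `false` is a default: an independent set has no across pair to be decided at this
  -- node.
  star-realizes h {S} S? ind = node (length L) false (λ i → leaf (lookup L i))
    , subst Unique (≡-sym leaves≡L) (Unique.filter⁺ S? (Unique.allFin⁺ _))
    , (λ v → subst (λ xs → (v ∈ xs) ⇔ S v) (≡-sym leaves≡L)
               (mk⇔ (proj₂ ∘ ∈-filter⁻ S? {xs = allFin _}) (∈-filter⁺ S? (∈-allFin v))))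
    , λ su sv ac → ⊥-elim (ind su sv ac)
    where
    L = filter S? (allFin _)
    leaves≡L : concatMap (λ i → [ lookup L i ]) (allFin (length L)) ≡ L
    leaves≡L = trans (cong concat (List.map-tabulate id ([_] ∘ lookup L)))
      (trans (cong concat (≡-sym (List.map-tabulate (lookup L) [_])))
      (trans (List.concat-map-[_] _) (List.tabulate-lookup L)))

  -- The additional level turns each independent leaf set into a star. Children are indexed by all
  -- of `V`; a label that names no vertex gives a subtree without leaves.
  good⇒tree : ∀ h {S} → Decidable S → Good h S → Σ (Tree V (suc h)) λ T → Realizes T S
  good⇒tree zero    S? ind = star-realizes 0 S? ind
  good⇒tree (suc h) S? (inj₁ ind) = star-realizes (suc h) S? ind
  good⇒tree (suc h) {S} S? (inj₂ (b , c , crossing , pieces)) =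
    node (n G) b (λ z → proj₁ (sub z))
    , unique-concatMap-allFin ls (λ z → proj₁ (proj₂ (sub z)))
        (λ a∈i a∈j → trans (≡-sym (proj₂ (label-of a∈i))) (proj₂ (label-of a∈j)))
    , (λ v → mk⇔ (λ v∈ → proj₁ (label-of (proj₂ (Equivalence.from (∈-concatMap-allFin ls) v∈))))
                 (λ sv → Equivalence.to (∈-concatMap-allFin ls) (c v , leaf-of sv)))
    , lca
    where
    sub : ∀ z → Σ (Tree V (suc h)) λ T → Realizes T (λ u → S u × c u ≡ z)
    sub z = good⇒tree h (λ u → S? u ×-dec (c u Fin.≟ z)) (pieces z)
    ls : V → List V
    ls z = leaves (proj₁ (sub z))
    label-of : ∀ {z v} → v ∈ ls z → S v × c v ≡ z
    label-of {z} {v} = Equivalence.to (proj₁ (proj₂ (proj₂ (sub z))) v)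
    leaf-of : ∀ {v} → S v → v ∈ ls (c v)
    leaf-of {v} sv = Equivalence.from (proj₁ (proj₂ (proj₂ (sub (c v)))) v) (sv , refl)
    lca : ∀ {u v} → S u → S v → Across u v →
          ∃ λ b′ → Lca (node (n G) b (λ z → proj₁ (sub z))) u v b′ × adj G u v ≡ b′
    lca {u} {v} su sv ac with c u Fin.≟ c v
    ... | no cu≢cv = b , here (c u) (c v) cu≢cv (leaf-of su) (leaf-of sv) , crossing su sv ac cu≢cv
    ... | yes cu≡cv =
      let b′ , l , eq = proj₂ (proj₂ (proj₂ (sub (c u)))) (su , refl) (sv , ≡-sym cu≡cv) ac
      in b′ , there (c u) l , eq

  -- Colourings, induced paths and attachments.

  Monochrome : {C : Set} → (V → C) → (V → Set) → Set
  Monochrome f S = ∀ {u v} → S u → S v → side u ≡ side v → f u ≡ f v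

  -- Speaks of all monochromatic subsets rather than of colour classes: such a subset may use one
  -- colour on each side, as the union of two parts of a cosplit does.
  Colouring : Set → ℕ → (V → Set) → Set₁
  Colouring C h S = Σ (V → C) λ f → ∀ {S′ : V → Set} → Decidable S′ → (∀ {u} → S′ u → S u) →
    Monochrome f S′ → Good h S′

  -- An induced path in the graph of `b`-edges, newest vertex first. `Start` restricts the oldest
  -- vertex, so that a round can be made to begin opposite a given vertex.
  data Path (b : Bool) (S Start : V → Set) : List V → Set where
    single : ∀ {x} → S x → Start x → Path b S Start (x ∷ [])
    extend : ∀ {x y ps} → S x → Edge b x y → All (λ p → ¬ Edge b x p) ps → All (x ≢_) (y ∷ ps) →
             Path b S Start (y ∷ ps) → Path b S Start (x ∷ y ∷ ps)

  On : Bool → (V → Set) → V → V → Set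
  On b S u v = S u × S v × Edge b u v

  On? : ∀ b {S} → Decidable S → ∀ u v → Dec (On b S u v)
  On? b S? u v = S? u ×-dec (S? v ×-dec Edge? b u v)

  open Components

  module _ {b} {S S₁ : V → Set} (S₁⊆S : ∀ {u} → S₁ u → S u)
           (K : Components (On b S)) (K₁ : Components (On b S₁)) where

    -- Carrying the `K`-label of `u` is invariant under the edges inside `S₁`, as these are also
    -- edges inside `S`.
    label-coarser : ∀ {u v} → label K₁ u ≡ label K₁ v → label K v ≡ label K u
    label-coarser {u} eq = closed K₁ (λ x → label K x ≡ label K u)
      (λ (sa , sb , e) → let same = joined K (S₁⊆S sa , S₁⊆S sb , e)
                         in mk⇔ (trans (≡-sym same)) (trans same))
      eq refl

    record Attachment (u : V) : Set where
      field
        {outer inner} : V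
        outer∈        : S outer
        outer∉        : ¬ S₁ outer
        outer-label   : label K outer ≡ label K u
        inner∈        : S₁ inner
        inner-label   : label K₁ inner ≡ label K₁ u
        edge          : Edge b outer inner

    -- By connectedness of the K-component of u, some edge joins the K₁-component of u to S ∖ S₁.
    attach : Decidable S → Decidable S₁ → ∀ {u m₀} → S₁ u → S m₀ → ¬ S₁ m₀ → label K m₀ ≡ label K u →
             Attachment u
    attach S? S₁? {u} {m₀} s₁u sm₀ ¬s₁m₀ eq
      with Fin.any? (λ m → Fin.any? (λ v →
             (S? m ×-dec (¬? (S₁? m) ×-dec (label K m Fin.≟ label K u)))
             ×-dec ((S₁? v ×-dec (label K₁ v Fin.≟ label K₁ u)) ×-dec Edge? b m v)))
    ... | yes (_ , _ , (sm , ¬s₁m , lm) , (s₁v , lv) , e) = record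
        { outer∈ = sm ; outer∉ = ¬s₁m ; outer-label = lm ; inner∈ = s₁v ; inner-label = lv ; edge = e }
    -- Without such an edge, the `K₁`-component of `u` is closed under the edges inside `S`. It then
    -- absorbs the whole `K`-component, including `m₀`, which is not in `S₁`.
    ... | no none = contradiction
        (proj₁ (closed K Piece (λ (sa , sb , e) → mk⇔ (stay sb e) (stay sa (edge-sym e)))
                 (≡-sym eq) (s₁u , refl)))
        ¬s₁m₀
      where
      Piece : V → Set
      Piece v = S₁ v × label K₁ v ≡ label K₁ u
      stay : ∀ {v w} → S w → Edge b v w → Piece v → Piece w
      stay {v} {w} sw e (s₁v , l) with S₁? w
      ... | yes s₁w = s₁w , trans (≡-sym (joined K₁ (s₁v , s₁w , e))) l
      ... | no ¬s₁w = contradiction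
        (w , v , (sw , ¬s₁w , trans (≡-sym (joined K (S₁⊆S s₁v , sw , e))) (label-coarser (≡-sym l)))
               , (s₁v , l) , edge-sym e) none

  -- Gyárfás levels along a growing path.

  module Gyárfás (b : Bool) (Ambient Start : V → Set) {C : Set} (c₀ : C) (h t : ℕ)
    (no-path : ∀ {ps} → Path b Ambient Start ps → length ps ≢ t)
    (refine : ∀ {x ps} {S : V → Set} → Decidable S → Path b Ambient Start (x ∷ ps) →
              (∀ {u} → S u → Ambient u × All (u ≢_) (x ∷ ps) × (Across x u → Edge b x u)
                             × All (λ p → ¬ Edge b p u) ps) →
              Colouring C h S)
    where

    -- The vertices of the label-z part of S hang from tip; the other path vertices do not see that part.
    record Tip (S : V → Set) (c : V → V) (l : ℕ) (z : V) : Set where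
      field
        {tip}   : V
        {tail}  : List V
        path    : Path b Ambient Start (tip ∷ tail)
        len     : length (tip ∷ tail) ≡ l
        outside : All (λ p → ¬ S p) (tip ∷ tail)
        far     : ∀ {v} → S v → c v ≡ z → All (λ p → ¬ Edge b p v) tail
        near    : ∃ λ v → (S v × c v ≡ z) × Edge b tip v
    open Tip

    Tip? : (S : V → Set) → (V → V) → ℕ → V → Set
    Tip? S c l z = (∀ {u} → S u → c u ≢ z) ⊎ Tip S c l z

    module _ {S : V → Set} {c : V → V} {l : ℕ} {z : V} where

      Dominated Full : Tip? S c l z → V → Set
      Dominated (inj₁ _) u = ⊥
      Dominated (inj₂ τ) u = Edge b (tip τ) u
      Full (inj₁ _) u = ⊥
      Full (inj₂ τ) u = Across (tip τ) u → Edge b (tip τ) u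

      Dominated? : ∀ s → Decidable (Dominated s)
      Dominated? (inj₁ _) u = no λ ()
      Dominated? (inj₂ τ) u = Edge? b (tip τ) u

      Full? : ∀ s → Decidable (Full s)
      Full? (inj₁ _) u = no λ ()
      Full? (inj₂ τ) u = Across? (tip τ) u →-dec Edge? b (tip τ) u

      -- Fullness can fail only opposite the tip, and that is the side of the dominated vertex `u`.
      not-full : ∀ s {u v} → Dominated s u → ¬ Full s v → ¬ (side v ≡ side u → Dominated s v)
      not-full (inj₂ τ) e ¬full dom = ¬full λ ac → dom (across-same ac (proj₁ e))

    -- Levels cost colours but no height: a monochromatic set either passes to the next level as a
    -- whole or is settled here by one node over the components. At `r = 0` a tip would end a path
    -- of the forbidden length, so `S` is empty.
    peel : ∀ r {l} {S} → Decidable S → (∀ {u} → S u → Ambient u) → (K : Components (On b S)) →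
           (∀ z → Tip? S (label K) l z) → l + r ≡ t → Colouring (LevelColour C r) (suc h) S
    peel zero {l} {S} S? S⊆A K tips l+0≡t = const tt , λ S′? S′⊆S mono → inj₁ λ su _ _ → empty (S′⊆S su)
      where
      empty : ∀ {u} → S u → ⊥
      empty {u} su with tips (label K u)
      ... | inj₁ none = none su refl
      ... | inj₂ τ = no-path (path τ) (trans (len τ) (trans (≡-sym (ℕ.+-identityʳ l)) l+0≡t))
    peel (suc r) {l} {S} S? S⊆A K tips l+r≡t = colour , good
      where
      c = label K

      S₁ : V → Set
      S₁ u = S u × ¬ Dominated (tips (c u)) u

      S₁? : Decidable S₁
      S₁? u = S? u ×-dec ¬? (Dominated? (tips (c u)) u)

      K₁ : Components (On b S₁)
      K₁ = components (On? b S₁?)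

      coarser : ∀ {u v} → label K₁ u ≡ label K₁ v → c v ≡ c u
      coarser = label-coarser proj₁ K K₁

      -- Some edge enters the surviving part from a removed vertex. That vertex is `b`-adjacent to
      -- the old tip, because it was removed, and to no earlier path vertex, by `far`; so it is the
      -- new tip.
      advance : ∀ {u} → S₁ u → (τ : Tip S c l (c u)) → tips (c u) ≡ inj₂ τ →
                Tip S₁ (label K₁) (suc l) (label K₁ u)
      advance {u} s₁u τ tips≡ = record
        { path    = extend (S⊆A outer∈) (edge-sym tip-outer)
                      (All.map (λ ¬e → ¬e ∘ edge-sym) (far τ outer∈ outer-label))
                      (All.map (λ { ¬s refl → ¬s outer∈ }) (outside τ)) (path τ)
        ; len     = cong suc (len τ)
        ; outside = outer∉ ∷ All.map (λ ¬s → ¬s ∘ proj₁) (outside τ)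
        ; far     = λ (sw , ¬dom) eq → let cw = coarser (≡-sym eq) in
                      (¬dom ∘ edge⇒dominated cw) ∷ far τ sw cw
        ; near    = inner , (inner∈ , inner-label) , edge }
        where
        edge⇒dominated : ∀ {w} → c w ≡ c u → Edge b (tip τ) w → Dominated (tips (c w)) w
        edge⇒dominated cw e rewrite cw | tips≡ = e
        dominated⇒edge : ∀ {w} → c w ≡ c u → Dominated (tips (c w)) w → Edge b (tip τ) w
        dominated⇒edge cw d rewrite cw | tips≡ = d
        attachment : Attachment proj₁ K K₁ u
        -- `near` supplies a removed vertex in the same component, as `attach` requires.
        attachment = let m₀ , (sm₀ , cm₀) , e₀ = near τ in
          attach proj₁ K K₁ S? S₁? s₁u sm₀ (λ (_ , ¬dom) → ¬dom (edge⇒dominated cm₀ e₀)) cm₀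
        open Attachment attachment
        tip-outer : Edge b (tip τ) outer
        tip-outer = decidable-stable (Edge? b (tip τ) outer)
          λ ¬e → outer∉ (outer∈ , ¬e ∘ dominated⇒edge outer-label)

      tips₁ : ∀ z → Tip? S₁ (label K₁) (suc l) z
      tips₁ z with Fin.any? (λ u → S₁? u ×-dec (label K₁ u Fin.≟ z))
      ... | no none = inj₁ λ s₁u eq → none (_ , s₁u , eq)
      ... | yes (u , s₁u , refl) = inj₂ (from (tips (c u)) refl)
        where
        from : ∀ s → tips (c u) ≡ s → Tip S₁ (label K₁) (suc l) (label K₁ u)
        from (inj₁ none) _ = contradiction refl (none (proj₁ s₁u))
        from (inj₂ τ) eq   = advance s₁u τ eq

      abstract
        rest : Colouring (LevelColour C r) (suc h) S₁
        rest = peel r S₁? (S⊆A ∘ proj₁) K₁ tips₁ (trans (≡-sym (ℕ.+-suc l r)) l+r≡t)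

      colour-piece : ∀ z → (s : Tip? S c l z) → Colouring C h (λ u → (S u × c u ≡ z) × Full s u)
      -- The piece is empty, and `c₀` is a placeholder colour.
      colour-piece z (inj₁ none) = const c₀ , λ _ sub _ → independent⇒good h λ su _ _ → proj₂ (sub su)
      colour-piece z (inj₂ τ) = refine (λ u → (S? u ×-dec (c u Fin.≟ z)) ×-dec Full? (inj₂ τ) u) (path τ)
        λ ((su , cu) , full) → S⊆A su , All.map (λ { ¬s refl → ¬s su }) (outside τ) , full , far τ su cu

      colour : V → LevelColour C (suc r)
      colour u = ⌊ S₁? u ⌋ , proj₁ (colour-piece (c u) (tips (c u))) u , proj₁ rest u

      good : ∀ {S′ : V → Set} → Decidable S′ → (∀ {u} → S′ u → S u) → Monochrome colour S′ → Good (suc h) S′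
      good {S′} S′? S′⊆S mono with Fin.any? (λ u → S′? u ×-dec ¬? (S₁? u))
      ... | no none = proj₂ rest S′?
        (λ {u} su → decidable-stable (S₁? u) λ ¬s₁u → none (u , su , ¬s₁u))
        (λ su sv same → cong (proj₂ ∘ proj₂) (mono su sv same))
      -- One removed vertex suffices: the survival bit is shared along its side, so every vertex of
      -- `S′` on the side of `u₀` is dominated by the tip of its component.
      ... | yes (u₀ , su₀ , ¬s₁u₀) = inj₂ (not b , c , crossing , pieces)
        where
        crossing : ∀ {u v} → S′ u → S′ v → Across u v → c u ≢ c v → adj G u v ≡ not b
        crossing su sv ac c≢ = nonedge ac λ e → c≢ (joined K (S′⊆S su , S′⊆S sv , e))

        dominated : ∀ {u z} → S′ u → c u ≡ z → side u ≡ side u₀ → Dominated (tips z) u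
        dominated {u} su refl same = decidable-stable (Dominated? (tips (c u)) u) λ ¬dom →
          ¬s₁u₀ (⌊⌋-transport (S₁? u) (S₁? u₀) (cong proj₁ (mono su su₀ same)) (S′⊆S su , ¬dom))

        pieces : ∀ z → Good h (λ u → S′ u × c u ≡ z)
        pieces z with Fin.any? (λ u → (S′? u ×-dec (c u Fin.≟ z)) ×-dec ¬? (Full? (tips z) u))
        ... | no none = proj₂ (colour-piece z (tips z)) (λ u → S′? u ×-dec (c u Fin.≟ z))
          (λ {u} (su , cu) → (S′⊆S su , cu) ,
             decidable-stable (Full? (tips z) u) λ ¬full → none (u , (su , cu) , ¬full))
          mono-piece
          where
          mono-piece : Monochrome (proj₁ (colour-piece z (tips z))) (λ u → S′ u × c u ≡ z)
          mono-piece {u} {v} (su , refl) (sv , cv) same = trans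
            (cong (proj₁ ∘ proj₂) (mono su sv same))
            (cong (λ z → proj₁ (colour-piece z (tips z)) v) cv)
        -- A vertex of this piece on the side of `u₀` would be dominated, hence put `u₁` on that
        -- side too, where `u₁` would be dominated as well. So the piece lies on the other side
        -- only.
        ... | yes (u₁ , (su₁ , cu₁) , ¬full) = independent⇒good h ind
          where
          absurd : ∀ {u} → S′ u × c u ≡ z → side u ≡ side u₀ → ⊥
          absurd (su , cu) same = not-full (tips z) (dominated su cu same) ¬full
            λ eq → dominated su₁ cu₁ (trans eq same)
          ind : Independent (λ u → S′ u × c u ≡ z)
          ind su sv ac = [ absurd su , absurd sv ]′ (across-meets u₀ ac)

  -- The first level: choosing a root in each component.

  root-step : ∀ b {S Start : V → Set} {C : Set} → C → ∀ h r → Decidable S → Decidable Start →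
    (∀ {u v} → S u → S v → Across u v → Start u ⊎ Start v) →
    (∀ {ps} → Path b S Start ps → length ps ≢ suc r) →
    (∀ {x ps} {S′ : V → Set} → Decidable S′ → Path b S Start (x ∷ ps) →
       (∀ {u} → S′ u → S u × All (u ≢_) (x ∷ ps) × (Across x u → Edge b x u)
                       × All (λ p → ¬ Edge b p u) ps) →
       Colouring C (suc h) S′) →
    Colouring (RootColour C r) (suc (suc h)) S
  root-step b {S} {Start} {C} c₀ h r S? Start? start-meets no-path refine = colour , good
    where
    open Gyárfás b S Start c₀ (suc h) (suc r) no-path refine

    K : Components (On b S)
    K = components (On? b S?)

    c = label K

    Root : V → Set
    Root z = ∃ λ ρ → S ρ × c ρ ≡ z × Start ρ

    root? : ∀ z → Dec (Root z)
    root? z = Fin.any? λ ρ → S? ρ ×-dec ((c ρ Fin.≟ z) ×-dec Start? ρ)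

    -- A component without a root is removed entirely; `start-meets` leaves no across pair in it.
    NonRoot : ∀ {z} → Dec (Root z) → V → Set
    NonRoot (yes (ρ , _)) u = u ≢ ρ
    NonRoot (no _)        u = ⊥

    NonRoot? : ∀ {z} (s : Dec (Root z)) → Decidable (NonRoot s)
    NonRoot? (yes (ρ , _)) u = ¬? (u Fin.≟ ρ)
    NonRoot? (no _)        u = no λ ()

    -- Settles pieces that contain their root: the root becomes uniform to the vertices of a
    -- monochromatic set that lie across from it.
    touch : ∀ {z} → Dec (Root z) → V → Bool
    touch (yes (ρ , _)) u = adj G ρ u
    touch (no _)        u = false

    S₁ : V → Set
    S₁ u = S u × NonRoot (root? (c u)) u

    S₁? : Decidable S₁
    S₁? u = S? u ×-dec NonRoot? (root? (c u)) u

    K₁ : Components (On b S₁)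
    K₁ = components (On? b S₁?)

    module _ {z ρ} {isRoot : S ρ × c ρ ≡ z × Start ρ} (eq : root? z ≡ yes (ρ , isRoot)) where

      nonroot : ∀ {w} → c w ≡ z → S₁ w → w ≢ ρ
      nonroot cw (_ , nr) rewrite cw | eq = nr

      root-only : ∀ {w} → c w ≡ z → S w → ¬ S₁ w → w ≡ ρ
      root-only {w} cw sw ¬s₁w = decidable-stable (w Fin.≟ ρ) λ w≢ρ → ¬s₁w (sw , lift w≢ρ)
        where
        lift : w ≢ ρ → NonRoot (root? (c w)) w
        lift w≢ρ rewrite cw | eq = w≢ρ

      touch-root : ∀ {w} → c w ≡ z → touch (root? (c w)) w ≡ adj G ρ w
      touch-root cw rewrite cw | eq = refl

    tips₁ : ∀ z → Tip? S₁ (label K₁) 1 z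
    tips₁ z with Fin.any? (λ u → S₁? u ×-dec (label K₁ u Fin.≟ z))
    ... | no none = inj₁ λ s₁u eq → none (_ , s₁u , eq)
    ... | yes (u , s₁u , refl) = inj₂ (from (root? (c u)) refl)
      where
      from : (s : Dec (Root (c u))) → root? (c u) ≡ s → Tip S₁ (label K₁) 1 (label K₁ u)
      from (no none) eq = ⊥-elim (subst (λ s → NonRoot s u) eq (proj₂ s₁u))
      from (yes (ρ , sρ , cρ , start)) eq = record
        { path    = single sρ start
        ; len     = refl
        ; outside = ρ∉S₁ ∷ []
        ; far     = λ _ _ → []
        ; near    = inner , (inner∈ , inner-label)
                    , subst (λ x → Edge b x inner) (root-only eq outer-label outer∈ outer∉) edge }
        where
        ρ∉S₁ : ¬ S₁ ρ
        ρ∉S₁ s₁ρ = nonroot eq cρ s₁ρ refl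
        attachment : Attachment proj₁ K K₁ u
        attachment = attach proj₁ K K₁ S? S₁? s₁u sρ ρ∉S₁ cρ
        open Attachment attachment

    abstract
      rest : Colouring (LevelColour C r) (suc (suc h)) S₁
      -- The path consists of the root alone, and length `suc r` is forbidden, which leaves `r`
      -- levels.
      rest = peel r S₁? proj₁ K₁ tips₁ refl

    colour : V → RootColour C r
    colour u = ⌊ S₁? u ⌋ , touch (root? (c u)) u , proj₁ rest u

    good : ∀ {S′ : V → Set} → Decidable S′ → (∀ {u} → S′ u → S u) → Monochrome colour S′ →
           Good (suc (suc h)) S′
    good {S′} S′? S′⊆S mono with Fin.any? (λ u → S′? u ×-dec ¬? (S₁? u))
    ... | no none = proj₂ rest S′?
      (λ {u} su → decidable-stable (S₁? u) λ ¬s₁u → none (u , su , ¬s₁u))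
      (λ su sv same → cong (proj₂ ∘ proj₂) (mono su sv same))
    -- On the side of `u₀`, the set `S′` contains only roots and vertices of components without a
    -- root.
    ... | yes (u₀ , su₀ , ¬s₁u₀) = inj₂ (not b , c , crossing , λ z → piece z (root? z) refl)
      where
      crossing : ∀ {u v} → S′ u → S′ v → Across u v → c u ≢ c v → adj G u v ≡ not b
      crossing su sv ac c≢ = nonedge ac λ e → c≢ (joined K (S′⊆S su , S′⊆S sv , e))

      not-S₁ : ∀ {u} → S′ u → side u ≡ side u₀ → ¬ S₁ u
      not-S₁ {u} su same s₁u = ¬s₁u₀ (⌊⌋-transport (S₁? u) (S₁? u₀) (cong proj₁ (mono su su₀ same)) s₁u)

      piece : ∀ z (s : Dec (Root z)) → root? z ≡ s → Good (suc h) (λ u → S′ u × c u ≡ z)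
      piece z (no none) _ = inj₁ λ (su , cu) (sv , cv) ac →
        [ (λ start → none (_ , S′⊆S su , cu , start)) , (λ start → none (_ , S′⊆S sv , cv , start)) ]′
        (start-meets (S′⊆S su) (S′⊆S sv) ac)
      piece z (yes (ρ , isRoot)) eq = star
        (Fin.any? λ v → (S′? v ×-dec (c v Fin.≟ z)) ×-dec Across? ρ v)
        where
        at-root : ∀ {u} → S′ u × c u ≡ z → side u ≡ side u₀ → u ≡ ρ
        at-root (su , cu) same = root-only eq cu (S′⊆S su) (not-S₁ su same)

        same-touch : ∀ {v w} → S′ v × c v ≡ z → S′ w × c w ≡ z → Across ρ v → Across ρ w →
                     adj G ρ v ≡ adj G ρ w
        same-touch (sv , cv) (sw , cw) ac ac′ = trans (≡-sym (touch-root eq cv))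
          (trans (cong (proj₁ ∘ proj₂) (mono sv sw (across-same ac ac′))) (touch-root eq cw))

        star : Dec (∃ λ v → (S′ v × c v ≡ z) × Across ρ v) → Good (suc h) (λ u → S′ u × c u ≡ z)
        star (no none) = inj₁ λ su sv ac →
          [ (λ same → none (_ , sv , subst (λ x → Across x _) (at-root su same) ac))
          , (λ same → none (_ , su , subst (λ x → Across x _) (at-root sv same) (across-sym ac)))
          ]′ (across-meets u₀ ac)
        -- Every across pair of the piece contains `ρ`, so one node with singleton children is
        -- enough; the height `suc h` of a piece has room for it.
        star (yes (v₁ , sv₁ , ac₁)) = inj₂ (adj G ρ v₁ , id , uniform , λ _ →
          independent⇒good h λ { (_ , refl) (_ , refl) (_ , u≢v) → u≢v refl })
          where
          uniform : ∀ {u v} → S′ u × c u ≡ z → S′ v × c v ≡ z → Across u v → u ≢ v →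
                    adj G u v ≡ adj G ρ v₁
          uniform su sv ac _ with across-meets u₀ ac
          ... | inj₁ same with refl ← at-root su same = same-touch sv sv₁ ac ac₁
          ... | inj₂ same with refl ← at-root sv same =
            trans (sym G _ _) (same-touch su sv₁ (across-sym ac) ac₁)

  -- Ladders and the recursion on their length.

  -- The relation between w and y themselves is left free, which makes the notion invariant under
  -- complementation and under exchanging the sides; 2k rungs still contain H_k.
  data Ladder : ℕ → (V → Set) → Set₁ where
    done : ∀ {S} → Ladder 0 S
    rung : ∀ {m w y} {S S′ : V → Set} → S w → S y → Across w y → (∀ {u} → S′ u → S u) →
           (∀ {u} → S′ u → u ≢ w × u ≢ y × (Across w u → adj G w u ≡ true)
                                         × (Across y u → adj G y u ≡ false)) →
           Ladder m S′ → Ladder (suc m) S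

  path-head : ∀ {b S Start x ps} → Path b S Start (x ∷ ps) → S x
  path-head (single sx _)       = sx
  path-head (extend sx _ _ _ _) = sx

  map-colouring : ∀ {C D h S} (ι : C → D) → (∀ {a b} → ι a ≡ ι b → a ≡ b) →
                  Colouring C h S → Colouring D h S
  map-colouring ι inj (f , good) = ι ∘ f , λ S? sub mono → good S? sub λ su sv same → inj (mono su sv same)

  module _ {r} (no-path : ∀ {b S Start ps} → Path b S Start ps → length ps ≢ suc r) where

    -- A rung is found within at most two rounds, one for `b = true` and one for `b = false`, each
    -- adding one level. If there is no rung at all, `S` has no across pair.
    ladder-colouring : ∀ m {S} → Decidable S → ¬ Ladder (suc m) S →
                       Colouring (MainColour r m) (suc (m * 2)) S
    ladder-colouring zero S? ¬L = const tt , λ _ sub _ → inj₁ λ su sv ac →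
      ¬L (rung {S′ = const ⊥} (sub su) (sub sv) ac (λ ()) (λ ()) done)
    ladder-colouring (suc m) {S} S? ¬L =
      root-step true (inj₁ (point r m)) (suc (m * 2)) r S? (λ _ → yes tt) (λ _ _ _ → inj₁ tt) no-path refine
      where
      C = MainColour r m

      -- `x` is full to `S′` and lacks an empty partner. Starting the paths for `b = false` across
      -- from `x` makes their first vertex such a partner.
      complement-step : ∀ {x S′} → S x → Decidable S′ → (∀ {u} → S′ u → S u) →
        (∀ {u} → S′ u → u ≢ x × (Across x u → adj G x u ≡ true)) →
        Colouring (RootColour C r) (suc (suc (m * 2))) S′
      complement-step {x} {S′} sx S′? S′⊆S full =
        root-step false (point r m) (m * 2) r S′? (Across? x) meets no-path refine′
        where
        meets : ∀ {u v} → S′ u → S′ v → Across u v → Across x u ⊎ Across x v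
        -- One end of the pair is on the side of `x`, so the other end is across from `x`.
        meets su sv ac@(eq , _) with across-meets x ac
        ... | inj₁ same = inj₂ (trans eq (cong op same) , ≢-sym (proj₁ (full sv)))
        ... | inj₂ same = inj₁ (trans (proj₁ (across-sym ac)) (cong op same) , ≢-sym (proj₁ (full su)))

        refine′ : ∀ {x′ ps} {S″ : V → Set} → Decidable S″ → Path false S′ (Across x) (x′ ∷ ps) →
          (∀ {u} → S″ u → S′ u × All (u ≢_) (x′ ∷ ps) × (Across x′ u → Edge false x′ u)
                         × All (λ p → ¬ Edge false p u) ps) →
          Colouring C (suc (m * 2)) S″
        refine′ S″? (single sx′ ac) prop = ladder-colouring m S″? λ L →
          ¬L (rung sx (S′⊆S sx′) ac (S′⊆S ∘ proj₁ ∘ prop)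
            (λ su → let s′u , ≢s , empty , _ = prop su ; u≢x , x-full = full s′u in
                    u≢x , All.head ≢s , x-full , proj₂ ∘ empty) L)
        -- At later levels the newest vertex is empty, and its predecessor, having no `false`-edge
        -- to the piece, is full.
        refine′ S″? (extend sx′ e _ _ path) prop = ladder-colouring m S″? λ L →
          ¬L (rung (S′⊆S (path-head path)) (S′⊆S sx′) (across-sym (proj₁ e)) (S′⊆S ∘ proj₁ ∘ prop)
            (λ su → let _ , ≢s , empty , ¬es = prop su in
                    All.head (All.tail ≢s) , All.head ≢s , (λ ac → nonedge ac (All.head ¬es)) , proj₂ ∘ empty) L)

      refine : ∀ {x ps} {S′ : V → Set} → Decidable S′ → Path true S (const ⊤) (x ∷ ps) →
        (∀ {u} → S′ u → S u × All (u ≢_) (x ∷ ps) × (Across x u → Edge true x u)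
                       × All (λ p → ¬ Edge true p u) ps) →
        Colouring (C ⊎ RootColour C r) (suc (suc (m * 2))) S′
      refine S′? (single sx _) prop = map-colouring inj₂ inj₂-injective
        (complement-step sx S′? (proj₁ ∘ prop)
          λ su → let _ , ≢s , x-full , _ = prop su in All.head ≢s , proj₂ ∘ x-full)
      -- The newest vertex is full and its predecessor empty, so one round was enough for the rung;
      -- `good-suc` pads the height to that of the other case.
      refine S′? (extend sx e _ _ path) prop = map-colouring inj₁ inj₁-injective
        (let f , good = ladder-colouring m S′? λ L →
               ¬L (rung sx (path-head path) (proj₁ e) (proj₁ ∘ prop)
                 (λ su → let _ , ≢s , x-full , ¬es = prop su in
                         All.head ≢s , All.head (All.tail ≢s) , proj₂ ∘ x-full ,
                         λ ac → nonedge ac (All.head ¬es)) L)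
         in f , λ S″? sub mono → good-suc (suc (m * 2)) (good S″? sub mono))

  -- Induced paths as semi-induced subgraphs.

  module _ {b : Bool} {S Start : V → Set} (d : V) where

    path-step : ∀ {ps} → Path b S Start ps → ∀ {i} → suc i < length ps →
                Edge b (nth d ps i) (nth d ps (suc i))
    path-step (single _ _) {zero} (s≤s ())
    path-step (single _ _) {suc i} (s≤s ())
    path-step (extend _ e _ _ path) {zero}  _        = e
    path-step (extend _ _ _ _ path) {suc i} (s≤s i<) = path-step path i<

    path-skip : ∀ {ps} → Path b S Start ps → ∀ {i j} → suc i < j → j < length ps →
                ¬ Edge b (nth d ps i) (nth d ps j)
    path-skip (single _ _) {j = zero} ()
    path-skip (single _ _) {j = suc j} _ (s≤s ())
    path-skip (extend _ _ ¬e _ path) {zero}  {suc (suc j)} _ (s≤s (s≤s j<)) = nth-all ¬e j<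
    path-skip (extend _ _ ¬e _ path) {zero}  {suc zero} (s≤s ())
    path-skip (extend _ _ _ _ path) {suc i} {suc j} (s≤s i<j) (s≤s j<) = path-skip path i<j j<

    path-distinct : ∀ {ps} → Path b S Start ps → ∀ {i j} → i < j → j < length ps →
                    nth d ps i ≢ nth d ps j
    path-distinct (single _ _) {j = zero} ()
    path-distinct (single _ _) {j = suc j} _ (s≤s ())
    path-distinct (extend _ _ _ x≢ path) {zero}  {suc j} _ (s≤s j<) = nth-all x≢ j<
    path-distinct (extend _ _ _ _ path)  {suc i} {suc j} (s≤s i<j) (s≤s j<) = path-distinct path i<j j<

  -- Even positions form the left side and odd positions the right side. For `b = false` the edges
  -- of the path are non-adjacent pairs, which produces the bipartite complement.
  path⇒semi-induced : ∀ b {S Start ps t} → Path b S Start ps → length ps ≡ suc t →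
                      SemiInduced (pathGraph b (suc t)) G
  path⇒semi-induced b {ps = ps@(x₀ ∷ _)} path refl = conclude b adjacency
    where
    t = length ps
    at : ℕ → V
    at = nth x₀ ps

    even-side : ∀ i → i * 2 < t → side (at (i * 2)) ≡ side x₀
    odd-side  : ∀ i → suc (i * 2) < t → side (at (suc (i * 2))) ≡ op (side x₀)
    even-side zero    _  = refl
    even-side (suc i) i< = trans (proj₁ (proj₁ (path-step x₀ path i<)))
      (trans (cong op (odd-side i (ℕ.<-trans (ℕ.n<1+n _) i<))) (op-involutive _))
    odd-side i i< = trans (proj₁ (proj₁ (path-step x₀ path i<)))
      (cong op (even-side i (ℕ.<-trans (ℕ.n<1+n _) i<)))

    distinct : ∀ i j → i * 2 < t → suc (j * 2) < t → at (i * 2) ≢ at (suc (j * 2))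
    distinct i j i< j< with ℕ.<-cmp (i * 2) (suc (j * 2))
    ... | tri< lt _ _ = path-distinct x₀ path lt j<
    ... | tri≈ _ eq _ = ⊥-elim (ℕ.even≢odd i j (trans (ℕ.*-comm 2 i) (trans eq (cong suc (ℕ.*-comm j 2)))))
    ... | tri> _ _ gt = ≢-sym (path-distinct x₀ path gt i<)

    across : ∀ i j → i * 2 < t → suc (j * 2) < t → Across (at (i * 2)) (at (suc (j * 2)))
    across i j i< j< = trans (odd-side j j<) (cong op (≡-sym (even-side i i<))) , distinct i j i< j<

    adjacency : ∀ i j → i * 2 < t → suc (j * 2) < t →
      adj G (at (i * 2)) (at (suc (j * 2))) ≡ (if consecutive i j then b else not b)
    adjacency i j i< j< with position i j
    ... | equal refl q rewrite q = proj₂ (path-step x₀ path j<)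
    ... | next refl q rewrite q = trans (sym G _ _) (proj₂ (path-step x₀ path i<))
    ... | before lt q rewrite q = nonedge (across i j i< j<)
            (path-skip x₀ path (s≤s (ℕ.*-monoˡ-< 2 lt)) j<)
    ... | after gt q rewrite q = nonedge (across i j i< j<)
            (path-skip x₀ path (ℕ.≤-trans (ℕ.n≤1+n _) (ℕ.*-monoˡ-≤ 2 gt)) i< ∘ edge-sym)

    bound-α : ∀ (i : Fin ⌈ t /2⌉) → toℕ i * 2 < t
    bound-α i = ceil-half-bound t (toℕ i) (Fin.toℕ<n i)

    bound-β : ∀ (j : Fin ⌊ t /2⌋) → suc (toℕ j * 2) < t
    bound-β j = half-bound t (toℕ j) (Fin.toℕ<n j)

    at-injective : ∀ {i j} → i < t → j < t → at i ≡ at j → i ≡ j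
    at-injective {i} {j} i< j< eq with ℕ.<-cmp i j
    ... | tri< lt _ _ = contradiction eq (path-distinct x₀ path lt j<)
    ... | tri≈ _ i≡j _ = i≡j
    ... | tri> _ _ gt = contradiction (≡-sym eq) (path-distinct x₀ path gt i<)

    α-injective : ∀ {i j : Fin ⌈ t /2⌉} → at (toℕ i * 2) ≡ at (toℕ j * 2) → i ≡ j
    α-injective {i} {j} eq = Fin.toℕ-injective
      (ℕ.*-cancelʳ-≡ _ _ 2 (at-injective (bound-α i) (bound-α j) eq))

    β-injective : ∀ {i j : Fin ⌊ t /2⌋} → at (suc (toℕ i * 2)) ≡ at (suc (toℕ j * 2)) → i ≡ j
    β-injective {i} {j} eq = Fin.toℕ-injective
      (ℕ.*-cancelʳ-≡ _ _ 2 (ℕ.suc-injective (at-injective (bound-β i) (bound-β j) eq)))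

    induced : ∀ {R} → (∀ i j → adj G (at (toℕ i * 2)) (at (suc (toℕ j * 2))) ≡ R i j) →
              SemiInduced (record { p = ⌈ t /2⌉ ; q = ⌊ t /2⌋ ; rel = R }) G
    induced eq = (λ i → at (toℕ i * 2)) , (λ j → at (suc (toℕ j * 2))) , α-injective , β-injective
      , (λ i j → distinct (toℕ i) (toℕ j) (bound-α i) (bound-β j)) , eq

    if-id : ∀ c → (if c then true else false) ≡ c
    if-id true  = refl
    if-id false = refl

    if-not : ∀ c → (if c then false else true) ≡ not c
    if-not true  = refl
    if-not false = refl

    conclude : ∀ b → (∀ i j → i * 2 < t → suc (j * 2) < t →
      adj G (at (i * 2)) (at (suc (j * 2))) ≡ (if consecutive i j then b else not b)) →
      SemiInduced (pathGraph b t) G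
    conclude true  eq = induced λ i j →
      trans (eq (toℕ i) (toℕ j) (bound-α i) (bound-β j)) (if-id (consecutive (toℕ i) (toℕ j)))
    conclude false eq = induced λ i j →
      trans (eq (toℕ i) (toℕ j) (bound-α i) (bound-β j)) (if-not (consecutive (toℕ i) (toℕ j)))

  -- From ladders to half-graphs.

  record Rungs (s₀ : Bool) (S : V → Set) (m : ℕ) : Set where
    field
      α β      : ℕ → V
      α∈       : ∀ {i} → i < m → S (α i)
      β∈       : ∀ {i} → i < m → S (β i)
      α-side   : ∀ {i} → i < m → side (α i) ≡ s₀
      β-side   : ∀ {i} → i < m → side (β i) ≡ op s₀
      disjoint : ∀ {i j} → i < m → j < m → α i ≢ β j
      upper    : ∀ {i j} → i < j → j < m → adj G (α i) (β j) ≡ true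
      lower    : ∀ {i j} → j < i → i < m → adj G (α i) (β j) ≡ false
  open Rungs

  -- A rung with `w` on side `s₀` goes to the front, since `w` is full to all later βs and `y` is
  -- empty to all later αs; otherwise it goes to the end. `d` is a default for the empty sequences.
  ladder⇒rungs : ∀ {m S} s₀ → V → (∀ x → side x ≡ s₀ ⊎ side x ≡ op s₀) → Ladder m S → Rungs s₀ S m
  ladder⇒rungs s₀ d sides done = record
    { α = const d ; β = const d ; α∈ = λ () ; β∈ = λ () ; α-side = λ () ; β-side = λ ()
    ; disjoint = λ () ; upper = λ _ () ; lower = λ _ () }
  ladder⇒rungs {suc m} {S} s₀ d sides (rung {w = w} {y} {S′ = S′} sw sy ac sub far ladder) =
    [ prepend , append ]′ (sides w)
    where
    R : Rungs s₀ S′ m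
    R = ladder⇒rungs s₀ d sides ladder

    w-full : ∀ {u} → S′ u → side u ≡ op (side w) → adj G w u ≡ true
    w-full su sd = let u≢w , _ , full , _ = far su in full (sd , ≢-sym u≢w)

    y-empty : ∀ {u} → S′ u → side u ≡ op (side y) → adj G y u ≡ false
    y-empty su sd = let _ , u≢y , _ , empty = far su in empty (sd , ≢-sym u≢y)

    op² : s₀ ≡ op (op s₀)
    op² = ≡-sym (op-involutive s₀)

    prepend : side w ≡ s₀ → Rungs s₀ S (suc m)
    prepend ws = record
      { α = λ { zero → w ; (suc i) → α R i }
      ; β = λ { zero → y ; (suc i) → β R i }
      ; α∈ = λ { {zero} _ → sw ; {suc i} (s≤s i<) → sub (α∈ R i<) }
      ; β∈ = λ { {zero} _ → sy ; {suc i} (s≤s i<) → sub (β∈ R i<) }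
      ; α-side = λ { {zero} _ → ws ; {suc i} (s≤s i<) → α-side R i< }
      ; β-side = λ { {zero} _ → ys ; {suc i} (s≤s i<) → β-side R i< }
      ; disjoint = λ { {zero}  {zero}  _ _ → proj₂ ac
                     ; {zero}  {suc j} _ (s≤s j<) → ≢-sym (proj₁ (far (β∈ R j<)))
                     ; {suc i} {zero}  (s≤s i<) _ → proj₁ (proj₂ (far (α∈ R i<)))
                     ; {suc i} {suc j} (s≤s i<) (s≤s j<) → disjoint R i< j< }
      ; upper = λ { {zero}  {suc j} _ (s≤s j<) → w-full (β∈ R j<) (trans (β-side R j<) (cong op (≡-sym ws)))
                  ; {suc i} {suc j} (s≤s i<j) (s≤s j<) → upper R i<j j< }
      ; lower = λ { {suc i} {zero} _ (s≤s i<) → trans (sym G _ _)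
                      (y-empty (α∈ R i<) (trans (α-side R i<) (trans op² (cong op (≡-sym ys)))))
                  ; {suc i} {suc j} (s≤s j<i) (s≤s i<) → lower R j<i i< } }
      where
      ys : side y ≡ op s₀
      ys = trans (proj₁ ac) (cong op ws)

    -- Here y is empty to all earlier βs and w is full to all earlier αs, so the rung goes last.
    append : side w ≡ op s₀ → Rungs s₀ S (suc m)
    append ws = record
      { α = α′ ; β = β′
      ; α∈ = λ i< → snoc-elim S (sub ∘ α∈ R) sy i<
      ; β∈ = λ i< → snoc-elim S (sub ∘ β∈ R) sw i<
      ; α-side = λ i< → snoc-elim (λ x → side x ≡ s₀) (α-side R) ys i<
      ; β-side = λ i< → snoc-elim (λ x → side x ≡ op s₀) (β-side R) ws i<
      ; disjoint = λ i< j< → snoc-elim (λ x → x ≢ β′ _)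
          (λ i<m → snoc-elim (α R _ ≢_) (disjoint R i<m) (proj₁ (far (α∈ R i<m))) j<)
          (snoc-elim (y ≢_) (λ j<m → ≢-sym (proj₁ (proj₂ (far (β∈ R j<m))))) (≢-sym (proj₂ ac)) j<)
          i<
      ; upper = up ; lower = low }
      where
      ys : side y ≡ s₀
      ys = trans (proj₁ ac) (trans (cong op ws) (op-involutive s₀))

      α′ = snoc m (α R) y
      β′ = snoc m (β R) w

      snoc-elim : ∀ (P : V → Set) {f x i} → (i < m → P (f i)) → P x → i < suc m → P (snoc m f x i)
      snoc-elim P {f} {x} pf px i< with ℕ.m<1+n⇒m<n∨m≡n i<
      ... | inj₁ i<m  = subst P (≡-sym (snoc-init m f x i<m)) (pf i<m)
      ... | inj₂ refl = subst P (≡-sym (snoc-last m f x)) px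

      up : ∀ {i j} → i < j → j < suc m → adj G (α′ i) (β′ j) ≡ true
      up {i} i<j j<
        rewrite snoc-init m (α R) y (ℕ.<-≤-trans i<j (ℕ.≤-pred j<)) =
        snoc-elim (λ x → adj G (α R i) x ≡ true) (upper R i<j)
          (trans (sym G _ _) (w-full (α∈ R i<m) (trans (α-side R i<m) (trans op² (cong op (≡-sym ws)))))) j<
        where i<m = ℕ.<-≤-trans i<j (ℕ.≤-pred j<)

      low : ∀ {i j} → j < i → i < suc m → adj G (α′ i) (β′ j) ≡ false
      low {i} {j} j<i i<
        rewrite snoc-init m (β R) w (ℕ.<-≤-trans j<i (ℕ.≤-pred i<)) =
        snoc-elim (λ x → adj G x (β R j) ≡ false) (lower R j<i)
          (y-empty (β∈ R j<m) (trans (β-side R j<m) (cong op (≡-sym ys)))) i<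
        where j<m = ℕ.<-≤-trans j<i (ℕ.≤-pred i<)

  -- Taking the αs with even and the βs with odd index avoids the unknown diagonal.
  rungs⇒half-graph : ∀ {s₀ S} k → Rungs s₀ S (k * 2) → SemiInduced (HalfGraph k) G
  rungs⇒half-graph k R = a , b , a-injective , b-injective
    , (λ i j → disjoint R (ℕ.<-trans (ℕ.n<1+n _) (bound i)) (bound j)) , adjacency
    where
    a b : Fin k → V
    a i = α R (toℕ i * 2)
    b j = β R (suc (toℕ j * 2))

    bound : ∀ (j : Fin k) → suc (toℕ j * 2) < k * 2
    bound j = ℕ.*-monoˡ-≤ 2 (Fin.toℕ<n j)

    adjacency : ∀ i j → adj G (a i) (b j) ≡ (toℕ i ≤ᵇ toℕ j)
    adjacency i j with toℕ i ℕ.≤? toℕ j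
    ... | yes i≤j = trans (upper R (s≤s (ℕ.*-monoˡ-≤ 2 i≤j)) (bound j)) (≡-sym (≤ᵇ-true i≤j))
    ... | no  i≰j = trans (lower R (ℕ.*-monoˡ-≤ 2 (ℕ.≰⇒> i≰j)) (ℕ.<-trans (ℕ.n<1+n _) (bound i)))
                          (≡-sym (≤ᵇ-false (ℕ.≰⇒> i≰j)))

    diagonal : ∀ i → adj G (a i) (b i) ≡ true
    diagonal i = trans (adjacency i i) (≤ᵇ-true {toℕ i} ℕ.≤-refl)

    -- Read off the adjacency: if `a i` and `a j` coincide, the edge from `a j` to `b j` is also one
    -- from `a i`, which forces `i ≤ j`; the converse is symmetric.
    a-injective : Injective _≡_ _≡_ a
    a-injective {i} {j} eq = Fin.toℕ-injective (ℕ.≤-antisym (below i j eq) (below j i (≡-sym eq)))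
      where
      below : ∀ i j → a i ≡ a j → toℕ i ≤ toℕ j
      below i j eq = ℕ.≤ᵇ⇒≤ _ _ (Equivalence.from Bool.T-≡
        (trans (≡-sym (adjacency i j)) (trans (cong (λ x → adj G x (b j)) eq) (diagonal j))))

    b-injective : Injective _≡_ _≡_ b
    b-injective {i} {j} eq = Fin.toℕ-injective (ℕ.≤-antisym (below i j eq) (below j i (≡-sym eq)))
      where
      below : ∀ i j → b i ≡ b j → toℕ i ≤ toℕ j
      below i j eq = ℕ.≤ᵇ⇒≤ _ _ (Equivalence.from Bool.T-≡
        (trans (≡-sym (adjacency i j)) (trans (cong (adj G (a i)) (≡-sym eq)) (diagonal i))))

  ladder⇒half-graph : ∀ k {S} → Ladder (suc k * 2) S → SemiInduced (HalfGraph (suc k)) G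
  ladder⇒half-graph k L@(rung {w = w} _ _ _ _ _ _) =
    rungs⇒half-graph (suc k) (ladder⇒rungs (side w) w (two-sided w) L)

  abstract
    -- A ladder with `2k+2` rungs contains the half-graph of order `k+1`, so the recursion runs with
    -- `2k+1` rungs. This gives height `4k+3`, and the star level of `good⇒tree` completes it to
    -- `4(k+1)`.
    height-bounded-colouring : ∀ r k → ¬ SemiInduced (PathBi (suc r)) G →
      ¬ SemiInduced (biComplement (PathBi (suc r))) G → ¬ SemiInduced (HalfGraph (suc k)) G →
      Colouring (MainColour r (suc (k * 2))) (suc (suc (k * 2) * 2)) (const ⊤)
    height-bounded-colouring r k ¬P ¬P̃ ¬H =
      ladder-colouring no-path (suc (k * 2)) (λ _ → yes tt) (¬H ∘ ladder⇒half-graph k)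
      where
      no-path : ∀ {b S Start ps} → Path b S Start ps → length ps ≢ suc r
      no-path {true}  path = ¬P ∘ path⇒semi-induced true path
      no-path {false} path = ¬P̃ ∘ path⇒semi-induced false path

-- Finiteness of the palettes.

Embeds : Set → Set
Embeds C = Σ ℕ λ N → Σ (C → Fin N) λ ι → ∀ {a b} → ι a ≡ ι b → a ≡ b

embeds-⊤ : Embeds ⊤
embeds-⊤ = 1 , const zero , λ _ → refl

embeds-Bool : Embeds Bool
embeds-Bool = 2 , (λ b → if b then zero else suc zero) , inj _ _
  where
  inj : ∀ a b → (if a then zero else suc zero) ≡ (if b then zero else suc {n = 1} zero) → a ≡ b
  inj true  true  _ = refl
  inj false false _ = refl
  inj true  false ()
  inj false true  ()

embeds-× : ∀ {C D} → Embeds C → Embeds D → Embeds (C × D)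
embeds-× (M , ι , ι-inj) (N , κ , κ-inj) = M * N , (λ (c , d) → combine (ι c) (κ d)) ,
  λ eq → let p , q = Fin.combine-injective _ _ _ _ eq in cong₂ _,_ (ι-inj p) (κ-inj q)

embeds-⊎ : ∀ {C D} → Embeds C → Embeds D → Embeds (C ⊎ D)
embeds-⊎ {C} {D} (M , ι , ι-inj) (N , κ , κ-inj) = M + N , code , inj _ _
  where
  code : C ⊎ D → Fin (M + N)
  code (inj₁ c) = ι c ↑ˡ N
  code (inj₂ d) = M ↑ʳ κ d

  inj : ∀ a b → code a ≡ code b → a ≡ b
  inj (inj₁ a) (inj₁ b) eq = cong inj₁ (ι-inj (Fin.↑ˡ-injective N _ _ eq))
  inj (inj₂ a) (inj₂ b) eq = cong inj₂ (κ-inj (Fin.↑ʳ-injective M _ _ eq))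
  inj (inj₁ a) (inj₂ b) eq
    with () ← trans (≡-sym (Fin.splitAt-↑ˡ M (ι a) N))
                    (trans (cong (splitAt M) eq) (Fin.splitAt-↑ʳ M N (κ b)))
  inj (inj₂ a) (inj₁ b) eq
    with () ← trans (≡-sym (Fin.splitAt-↑ʳ M N (κ a)))
                    (trans (cong (splitAt M) eq) (Fin.splitAt-↑ˡ M (ι b) N))

embeds-root : ∀ {C} r → Embeds C → Embeds (RootColour C r)
embeds-root {C} r finite = embeds-× embeds-Bool (embeds-× embeds-Bool (level r))
  where
  level : ∀ r → Embeds (LevelColour C r)
  level zero    = embeds-⊤
  level (suc r) = embeds-× embeds-Bool (embeds-× finite (level r))

abstract
  embeds-main : ∀ r m → Embeds (MainColour r m)
  embeds-main r zero    = embeds-⊤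
  embeds-main r (suc m) =
    embeds-root r (embeds-⊎ (embeds-main r m) (embeds-root r (embeds-main r m)))

-- Renumbering the colours in use.

record Image {m N} (f : Fin m → Fin N) : Set where
  field
    size       : ℕ
    index      : Fin m → Fin size
    value      : Fin size → Fin N
    injective  : ∀ {i j} → value i ≡ value j → i ≡ j
    value∘index : ∀ v → value (index v) ≡ f v
    surjective : ∀ i → ∃ λ v → index v ≡ i

abstract
  -- The parts of a cosplit are nonempty, so only colours that occur may be kept; a new index is
  -- created when the value at `zero` does not occur later.
  image : ∀ {m N} (f : Fin m → Fin N) → Image f
  image {zero} f = record { size = 0 ; index = λ () ; value = λ () ; injective = λ { {()} }
                          ; value∘index = λ () ; surjective = λ () }
  image {suc m} f with image (f ∘ suc)
  ... | I with Fin.any? (λ i → Image.value I i Fin.≟ f zero)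
  ...   | yes (i₀ , eq) = record
    { size = size ; index = λ { zero → i₀ ; (suc v) → index v } ; value = value ; injective = injective
    ; value∘index = λ { zero → eq ; (suc v) → value∘index v }
    ; surjective = λ i → let v , e = surjective i in suc v , e }
    where open Image I
  ...   | no new = record
    { size = suc size
    ; index = λ { zero → zero ; (suc v) → suc (index v) }
    ; value = λ { zero → f zero ; (suc i) → value i }
    ; injective = λ { {zero} {zero} _ → refl
                    ; {zero} {suc j} eq → contradiction (j , ≡-sym eq) new
                    ; {suc i} {zero} eq → contradiction (i , eq) new
                    ; {suc i} {suc j} eq → cong suc (injective eq) }
    ; value∘index = λ { zero → refl ; (suc v) → value∘index v }
    ; surjective = λ { zero → zero , refl ; (suc i) → let v , e = surjective i in suc v , cong suc e } }
    where open Image I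

-- Assembling the cosplit.

theorem1p9 : ∀ (t k : ℕ) → ∃ λ (N : ℕ) → ∀ (G : Graph) →
    ¬ SemiInduced (PathBi t) G →
    ¬ SemiInduced (biComplement (PathBi t)) G →
    ¬ SemiInduced (HalfGraph k) G →
    Σ ℕ λ s → s ≤ N × Σ (Fin (n G) → Fin s) λ P → Is2Cosplit G s P (4 * k)
-- The path without vertices is semi-induced in every graph, so no graph qualifies; likewise for the
-- empty half-graph below.
theorem1p9 zero k = 0 , λ G ¬P _ _ →
  ⊥-elim (¬P ((λ ()) , (λ ()) , (λ { {()} }) , (λ { {()} }) , (λ ()) , λ ()))
theorem1p9 (suc r) zero = 0 , λ G _ _ ¬H →
  ⊥-elim (¬H ((λ ()) , (λ ()) , (λ { {()} }) , (λ { {()} }) , (λ ()) , λ ()))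
-- A vertex gets one of `N` classes and, for each of the `N` classes, one of `N` colours in the cut
-- between that class and the rest.
theorem1p9 (suc r) (suc k) = N * N ^ N , cosplit
  where
  finite = embeds-main r (suc (k * 2))
  N = proj₁ finite
  ι = proj₁ (proj₂ finite)
  ι-injective = proj₂ (proj₂ finite)

  height : suc (suc (suc (k * 2) * 2)) ≡ 4 * suc k
  height = trans (cong (4 +_) (trans (ℕ.*-assoc k 2 2) (ℕ.*-comm k 4))) (≡-sym (ℕ.*-suc 4 k))

  cosplit : ∀ (G : Graph) → ¬ SemiInduced (PathBi (suc r)) G →
    ¬ SemiInduced (biComplement (PathBi (suc r))) G → ¬ SemiInduced (HalfGraph (suc k)) G →
    Σ ℕ λ s → s ≤ N * N ^ N × Σ (Fin (n G) → Fin s) λ P → Is2Cosplit G s P (4 * suc k)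
  cosplit G ¬P ¬P̃ ¬H = size , Fin.injective⇒≤ injective , index ,
    subst (Is2Cosplit G size index) height (surjective , cograph , bicograph)
    where
    V = Fin (n G)

    module Whole = Split G (const true) id (λ _ → refl) (λ _ _ → inj₁ refl)
    whole = Whole.height-bounded-colouring r k ¬P ¬P̃ ¬H

    class : V → Fin N
    class = ι ∘ proj₁ whole

    inClass : Fin N → V → Bool
    inClass i v = ⌊ class v Fin.≟ i ⌋

    complementary : ∀ a b → b ≡ a ⊎ b ≡ not a
    complementary true  true  = inj₁ refl
    complementary true  false = inj₂ refl
    complementary false true  = inj₂ refl
    complementary false false = inj₁ refl

    module Cut (i : Fin N) =
      Split G (inClass i) not Bool.not-involutive (λ u x → complementary (inClass i u) (inClass i x))
    cut : ∀ i → Cut.Colouring i _ _ _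
    cut i = Cut.height-bounded-colouring i r k ¬P ¬P̃ ¬H

    colour : V → Fin (N * N ^ N)
    colour v = combine (class v) (funToFin (λ i → ι (proj₁ (cut i) v)))

    open Image (image colour)

    same-colour : ∀ {u v} → index u ≡ index v → colour u ≡ colour v
    same-colour eq = trans (≡-sym (value∘index _)) (trans (cong value eq) (value∘index _))

    same-class : ∀ {u v} → index u ≡ index v → class u ≡ class v
    same-class eq = Fin.combine-injectiveˡ _ _ _ _ (same-colour eq)

    same-cut : ∀ i {u v} → index u ≡ index v → proj₁ (cut i) u ≡ proj₁ (cut i) v
    same-cut i {u} {v} eq = ι-injective (trans (≡-sym (Fin.finToFun-funToFin _ i))
      (trans (cong (λ c → finToFun c i) (Fin.combine-injectiveʳ (class u) _ (class v) _ (same-colour eq)))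
             (Fin.finToFun-funToFin _ i)))

    whole-tree : ∀ {S : V → Set} → Decidable S → (∀ {u v} → S u → S v → class u ≡ class v) →
      Σ (Tree V (suc (suc (suc (k * 2) * 2)))) λ T → Whole.Realizes T S
    whole-tree S? same = Whole.good⇒tree _ S?
      (proj₂ whole S? (λ _ → tt) (λ su sv _ → ι-injective (same su sv)))

    cograph : ∀ i → IsCographOn G (λ v → index v ≡ i) _
    cograph i =
      let T , uniq , mem , lca = whole-tree (λ v → index v Fin.≟ i)
                                   (λ p q → same-class (trans p (≡-sym q)))
      in T , uniq , mem , λ u v pu pv u≢v → lca pu pv (refl , u≢v)

    bicograph : ∀ i j → i ≢ j → IsBiCographOn G (λ v → index v ≡ i) (λ v → index v ≡ j) _
    bicograph i j i≢j with surjective i | surjective j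
    ... | a , a∈i | b , b∈j = build (class b Fin.≟ class a)
      where
      S : V → Set
      S v = index v ≡ i ⊎ index v ≡ j

      S? : Decidable S
      S? v = (index v Fin.≟ i) ⊎-dec (index v Fin.≟ j)

      apart : ∀ {u v} → index u ≡ i → index v ≡ j → u ≢ v
      apart p q refl = i≢j (trans (≡-sym p) q)

      class-i : ∀ {v} → index v ≡ i → class v ≡ class a
      class-i p = same-class (trans p (≡-sym a∈i))

      class-j : ∀ {v} → index v ≡ j → class v ≡ class b
      class-j p = same-class (trans p (≡-sym b∈j))

      build : Dec (class b ≡ class a) → IsBiCographOn G (λ v → index v ≡ i) (λ v → index v ≡ j) _
      -- Both parts lie in one class, so a cotree for their union already decides the pairs between
      -- them.
      build (yes eq) =
        let T , uniq , mem , lca = whole-tree S? (λ su sv → trans (to-a su) (≡-sym (to-a sv)))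
        in T , uniq , mem , λ u v pu pv → lca (inj₁ pu) (inj₂ pv) (refl , apart pu pv)
        where
        to-a : ∀ {v} → S v → class v ≡ class a
        to-a = [ class-i , (λ q → trans (class-j q) eq) ]′
      -- The cut around the class of the first part has that part on one side and the second part on
      -- the other, each with a single cut colour.
      build (no neq) =
        let T , uniq , mem , lca = Cut.good⇒tree c _ S? (proj₂ (cut c) S? (λ _ → tt) mono)
        in T , uniq , mem , λ u v pu pv → lca (inj₁ pu) (inj₂ pv)
             (trans (out pv) (cong not (≡-sym (in-c pu))) , apart pu pv)
        where
        c = class a
        in-c : ∀ {v} → index v ≡ i → inClass c v ≡ true
        in-c {v} p with class v Fin.≟ c
        ... | yes _ = refl
        ... | no ¬p = contradiction (class-i p) ¬p
        out : ∀ {v} → index v ≡ j → inClass c v ≡ false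
        out {v} q with class v Fin.≟ c
        ... | yes p = contradiction (trans (≡-sym (class-j q)) p) neq
        ... | no _  = refl
        mono : Cut.Monochrome c (proj₁ (cut c)) S
        mono (inj₁ p) (inj₁ q) _ = same-cut c (trans p (≡-sym q))
        mono (inj₂ p) (inj₂ q) _ = same-cut c (trans p (≡-sym q))
        mono (inj₁ p) (inj₂ q) eq = contradiction (trans (≡-sym (in-c p)) (trans eq (out q))) λ ()
        mono (inj₂ p) (inj₁ q) eq = contradiction (trans (≡-sym (out p)) (trans eq (in-c q))) λ ()
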